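{- For every odd integer $n\ge 3$, the cycle $C_n$ on $n$ vertices satisfies \[ \overline{\mathrm{lcs}}(C_n)=n-1. \]
   Context: $[k]=\{1,\dots,k\}$ and $\chi(G)$ is the chromatic number of a graph $G=(V,E)$. For a proper coloring $c:V\to[\chi(G)]$, a determining set for $(G,c)$ is a set $S\subseteq V$ such that for every proper coloring $c':V\to[\chi(G)]$ of $G$, if $c'|_S=c|_S$ then $c'=c$ on all of $V$. A critical set for $(G,c)$ is a determining set for $(G,c)$ that is minimal under inclusion. Define $\mathrm{lcs}(G,c)=\max\{|X| : X \text{ is a critical set for } (G,c)\}$ and $\overline{\mathrm{lcs}}(G)=\max_c \mathrm{lcs}(G,c)$, where the maximum is over all proper colorings $c:V\to[\chi(G)]$. -}

module Defs where

open import Data.Fin using (Fin; toℕ)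
open import Data.Fin.Subset using (Subset; _∈_; _⊆_; ∣_∣)
open import Data.Nat using (ℕ; suc; _≤_; s≤s)
open import Data.Nat.Properties using (1+n≢n)
open import Data.Product using (_×_; _,_; ∃-syntax)
open import Data.Sum using (_⊎_; inj₁; inj₂; swap)
open import Level using (0ℓ)
open import Relation.Binary.Core using (Rel)
open import Relation.Binary.Definitions using (Symmetric)
open import Relation.Binary.PropositionalEquality using (_≡_; _≢_; sym; trans; cong)
open import Relation.Nullary using (¬_)

record Graph (n : ℕ) : Set₁ where
  field
    Adj     : Rel (Fin n) 0ℓ
    adj-sym : Symmetric Adj
    no-loop : ∀ v → ¬ Adj v v

open Graph public

record ProperColoring {n : ℕ} (G : Graph n) (k : ℕ) : Set where
  field
    color  : Fin n → Fin k
    proper : ∀ {u v} → Adj G u v → color u ≢ color v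

open ProperColoring public

IsMaximum : (ℕ → Set) → ℕ → Set
IsMaximum P m = P m × (∀ k → P k → k ≤ m)

IsMinimum : (ℕ → Set) → ℕ → Set
IsMinimum P m = P m × (∀ k → P k → m ≤ k)

-- Numerical invariants are given as relations: `IsChromaticNumber G k`
-- reads "χ(G) = k", `IsLcs c m` reads "lcs(G,c) = m", and `IsLcsBar G m`
-- reads "max over c of lcs(G,c) is m".

IsChromaticNumber : ∀ {n} → Graph n → ℕ → Set
IsChromaticNumber G = IsMinimum (ProperColoring G)

module _ {n k : ℕ} {G : Graph n} (c : ProperColoring G k) where

  IsDetermining : Subset n → Set
  IsDetermining S =
    (c′ : ProperColoring G k) →
    (∀ {v} → v ∈ S → color c′ v ≡ color c v) →
    ∀ v → color c′ v ≡ color c v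

  IsCritical : Subset n → Set
  IsCritical S =
    IsDetermining S × (∀ T → IsDetermining T → T ⊆ S → T ≡ S)

  IsLcs : ℕ → Set
  IsLcs = IsMaximum (λ m → ∃[ X ] (IsCritical X × ∣ X ∣ ≡ m))

IsLcsBar : ∀ {n} → Graph n → ℕ → Set
IsLcsBar G m =
  ∃[ χ ] (IsChromaticNumber G χ ×
          IsMaximum (λ l → ∃[ c ] IsLcs {k = χ} {G = G} c l) m)

-- j is the cyclic successor of i: either j = i + 1, or i = n - 1 and j = 0.
Next : ∀ {n} → Rel (Fin n) 0ℓ
Next {n} i j = (toℕ j ≡ suc (toℕ i)) ⊎ (suc (toℕ i) ≡ n × toℕ j ≡ 0)

Cycle : (n : ℕ) → 3 ≤ n → Graph n
Cycle n 3≤n = record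
  { Adj     = λ i j → Next i j ⊎ Next j i
  ; adj-sym = swap
  ; no-loop = λ { v (inj₁ e) → irrefl 3≤n v e ; v (inj₂ e) → irrefl 3≤n v e }
  }
  where
  irrefl : ∀ {n} → 3 ≤ n → (v : Fin n) → ¬ Next v v
  irrefl _ v (inj₁ e) = 1+n≢n (sym e)
  irrefl (s≤s (s≤s _)) v (inj₂ (p , q)) with trans (sym p) (cong suc q)
  ... | ()

{-# OPTIONS --safe #-}

-- Upper bound: if every vertex of an odd cycle had equally coloured neighbours,
-- then the vertices 0, 2, …, n − 1 would all share one colour, although n − 1
-- and 0 are adjacent. So some v has differently coloured neighbours; these force
-- the colour of v, and V itself is not minimal. The three distinct colours
-- around v also give χ ≥ 3.
-- Lower bound: colour vertex 0 with 2 and the others alternately with 0 and 1.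
-- V ∖ {0} is determining. If a further vertex u is omitted, then u may be
-- recoloured with 2, since afterwards vertex 0 still finds a colour different
-- from those of its two neighbours.
module Submission where

open import Data.Fin using (Fin; zero; suc; toℕ)
open import Data.Fin.Patterns using (0F; 1F; 2F)
open import Data.Fin.Properties using (_≟_; all?; any?; toℕ-fromℕ<; toℕ-injective; injective⇒≤)
open import Data.Fin.Subset using (_∈_; _⊆_; _∉_; ⊤; ⁅_⁆; ∁; ∣_∣)
open import Data.Fin.Subset.Properties
  using (_∈?_; ∈⊤; ⊆⊤; ⊆-antisym; x∈⁅x⁆; x∈⁅y⁆⇒x≡y; x∈p⇒x∉∁p; x∉p⇒x∈∁p;
         ∣p∣≤n; ∣p∣≡n⇒p≡⊤; ∣∁p∣≡n∸∣p∣; ∣⁅x⁆∣≡1)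
open import Data.Nat using (ℕ; zero; suc; _≤_; _<_; _∸_; _%_; _/_; _+_; _*_; s≤s; s≤s⁻¹)
import Data.Nat.Properties as ℕ
open import Data.Nat.DivMod using (_mod_; m≡m%n+[m/n]*n; m<n⇒m%n≡m; m%n<n)
open import Data.Product using (_×_; _,_; proj₂; ∃-syntax)
open import Data.Sum using (inj₁; inj₂)
open import Function using (_∘_)
open import Relation.Binary.PropositionalEquality
  using (_≡_; _≢_; refl; sym; trans; cong; subst; ≢-sym)
open import Relation.Nullary using (yes; no; ¬?; contradiction)
open import Relation.Nullary.Decidable using (from-yes; _×-dec_; _→-dec_; decidable-stable)
open import Defs

third-color : ∀ a b → ∃[ x ] (x ≢ a × x ≢ b)
third-color = from-yes (all? {n = 3} λ a → all? {n = 3} λ b → any? {n = 3} λ x →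
  ¬? (x ≟ a) ×-dec ¬? (x ≟ b))

third-color-unique : ∀ (a b x y : Fin 3) → a ≢ b →
                     x ≢ a → x ≢ b → y ≢ a → y ≢ b → x ≡ y
third-color-unique = from-yes (all? {n = 3} λ a → all? {n = 3} λ b →
  all? {n = 3} λ x → all? {n = 3} λ y →
  ¬? (a ≟ b) →-dec ¬? (x ≟ a) →-dec ¬? (x ≟ b) →-dec
  ¬? (y ≟ a) →-dec ¬? (y ≟ b) →-dec (x ≟ y))

distinct⇒3≤ : ∀ {k} {a b c : Fin k} → a ≢ b → b ≢ c → a ≢ c → 3 ≤ k
distinct⇒3≤ {k} {a} {b} {c} a≢b b≢c a≢c = injective⇒≤ {f = f} f-injective
  where
  f : Fin 3 → Fin k
  f 0F = a
  f 1F = b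
  f 2F = c
  f-injective : ∀ {x y} → f x ≡ f y → x ≡ y
  f-injective {0F} {0F} _ = refl
  f-injective {0F} {1F} e = contradiction e a≢b
  f-injective {0F} {2F} e = contradiction e a≢c
  f-injective {1F} {0F} e = contradiction (sym e) a≢b
  f-injective {1F} {1F} _ = refl
  f-injective {1F} {2F} e = contradiction e b≢c
  f-injective {2F} {0F} e = contradiction (sym e) a≢c
  f-injective {2F} {1F} e = contradiction (sym e) b≢c
  f-injective {2F} {2F} _ = refl

-- A sequence whose ends differ must change at some single step: look at the last step if
-- `g 0 ≡ g j`, otherwise shorten the sequence.
change : ∀ {k} (g : ℕ → Fin k) j → g 0 ≢ g j → ∃[ i ] (i < j × g i ≢ g (suc i))
change g zero    g0≢gj = contradiction refl g0≢gj
change g (suc j) g0≢gj with g 0 ≟ g j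
... | yes g0≡gj = j , ℕ.n<1+n j , g0≢gj ∘ trans g0≡gj
... | no  g0≢gj′ with i , i<j , gi≢ ← change g j g0≢gj′ = i , ℕ.m<n⇒m<1+n i<j , gi≢

toℕ-mod : ∀ {i m} → i ≤ m → toℕ (i mod suc m) ≡ i
toℕ-mod {i} {m} i≤m = trans (toℕ-fromℕ< (m%n<n i (suc m))) (m<n⇒m%n≡m (s≤s i≤m))

Forced : ∀ {n k} {G : Graph n} → ProperColoring G k → Fin n → Set
Forced {G = G} c v = ∃[ a ] ∃[ b ] (Adj G a v × Adj G v b × color c a ≢ color c b)

-- The number of colours stays arbitrary because this result also bounds the chromatic number from
-- below.
odd-cycle-forced : ∀ {j k} (3≤n : 3 ≤ suc (j * 2)) (c : ProperColoring (Cycle (suc (j * 2)) 3≤n) k) →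
                   ∃[ v ] Forced c v
odd-cycle-forced {j} 3≤n c = forced (change (λ i → color c (w (i * 2))) j ends≢)
  where
  w : ℕ → Fin (suc (j * 2))
  w i = i mod suc (j * 2)
  ends≢ : color c (w 0) ≢ color c (w (j * 2))
  -- Steps of two from 0 end exactly at the last vertex `j * 2`; the wrap-around edge joins it to 0.
  ends≢ = proper c (inj₂ (inj₂ (cong suc (toℕ-mod ℕ.≤-refl) , refl)))
  next : ∀ {i} → suc i ≤ j * 2 → Next (w i) (w (suc i))
  next i<m = inj₁ (trans (toℕ-mod i<m) (cong suc (sym (toℕ-mod (ℕ.<⇒≤ i<m)))))
  forced : ∃[ i ] (i < j × color c (w (i * 2)) ≢ color c (w (suc i * 2))) → ∃[ v ] Forced c v
  forced (i , i<j , gi≢) =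
    -- The forced vertex is the odd one between the two even positions where the colour changes.
    w (suc (i * 2)) , w (i * 2) , w (suc i * 2) ,
    inj₁ (next (ℕ.<⇒≤ i2<)) , inj₁ (next i2<) , gi≢
    where
    i2< : suc i * 2 ≤ j * 2
    i2< = ℕ.*-monoˡ-≤ 2 i<j

forced⇒3≤ : ∀ {n k} {G : Graph n} (c : ProperColoring G k) {v} → Forced c v → 3 ≤ k
forced⇒3≤ c (_ , _ , av , vb , a≢b) = distinct⇒3≤ (proper c av) (proper c vb) a≢b

x≢y⇒x∈∁⁅y⁆ : ∀ {n} {x y : Fin n} → x ≢ y → x ∈ ∁ ⁅ y ⁆
x≢y⇒x∈∁⁅y⁆ x≢y = x∉p⇒x∈∁p (x≢y ∘ x∈⁅y⁆⇒x≡y _)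

x∉∁⁅x⁆ : ∀ {n} (x : Fin n) → x ∉ ∁ ⁅ x ⁆
x∉∁⁅x⁆ x = x∈p⇒x∉∁p (x∈⁅x⁆ x)

∣∁⁅x⁆∣≡n∸1 : ∀ {n} (x : Fin n) → ∣ ∁ ⁅ x ⁆ ∣ ≡ n ∸ 1
∣∁⁅x⁆∣≡n∸1 {n} x = trans (∣∁p∣≡n∸∣p∣ ⁅ x ⁆) (cong (n ∸_) (∣⁅x⁆∣≡1 x))

module _ {n} {G : Graph n} (c : ProperColoring G 3) {v} (forced : Forced c v) where

  forced⇒determining : IsDetermining c (∁ ⁅ v ⁆)
  forced⇒determining c′ agree w with w ≟ v
  ... | no  w≢v  = agree (x≢y⇒x∈∁⁅y⁆ w≢v)
  ... | yes refl = color-v forced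
    where
    neighbour-agrees : ∀ {u} → Adj G u v → color c′ u ≡ color c u
    neighbour-agrees uv = agree (x≢y⇒x∈∁⁅y⁆ λ { refl → no-loop G v uv })
    color-v : Forced c v → color c′ v ≡ color c v
    color-v (a , b , av , vb , a≢b) =
      -- At `v` both colourings avoid the two distinct colours of `a` and `b`, which leaves one
      -- colour out of three.
      third-color-unique (color c a) (color c b) _ _ a≢b
        (λ e → proper c′ av (trans (neighbour-agrees av) (sym e)))
        (λ e → proper c′ vb (trans e (sym (neighbour-agrees (adj-sym G vb)))))
        (≢-sym (proper c av)) (proper c vb)

  forced⇒critical-< : ∀ {X} → IsCritical c X → ∣ X ∣ < n
  forced⇒critical-< {X} (_ , minimal) = ℕ.≤∧≢⇒< (∣p∣≤n X) λ ∣X∣≡n →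
    let X≡⊤ = ∣p∣≡n⇒p≡⊤ ∣X∣≡n
        ∁v≡X = minimal (∁ ⁅ v ⁆) forced⇒determining (subst (∁ ⁅ v ⁆ ⊆_) (sym X≡⊤) ⊆⊤)
    in x∉∁⁅x⁆ v (subst (v ∈_) (sym (trans ∁v≡X X≡⊤)) ∈⊤)

module _ {m k} (3≤n : 3 ≤ suc (suc m)) (x : Fin k) (f : ℕ → Fin k)
         (step : ∀ i → f i ≢ f (suc i)) (x≢first : x ≢ f 0) (x≢last : x ≢ f m) where

  -- The cycle is cut open at vertex 0. Position `i` of the remaining path is vertex `suc i`, so the
  -- neighbours of 0 carry `f 0` and `f m`.
  around : Fin (suc (suc m)) → Fin k
  around zero    = x
  around (suc i) = f (toℕ i)

  around-next : ∀ {u v} → Next u v → around u ≢ around v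
  around-next {zero}  {suc v} (inj₁ e) rewrite ℕ.suc-injective e = x≢first
  around-next {suc u} {suc v} (inj₁ e) rewrite ℕ.suc-injective e = step (toℕ u)
  around-next {zero}  {zero}  (inj₂ (() , _))
  around-next {suc u} {zero}  (inj₂ (e , _))
    rewrite ℕ.suc-injective (ℕ.suc-injective e) = ≢-sym x≢last

  around-coloring : ProperColoring (Cycle (suc (suc m)) 3≤n) k
  around-coloring = record
    { color  = around
    ; proper = λ { (inj₁ uv) → around-next uv ; (inj₂ vu) → ≢-sym (around-next vu) }
    }

alt : ℕ → Fin 3
alt 0             = 0F
alt 1             = 1F
alt (suc (suc i)) = alt i

alt-step : ∀ i → alt i ≢ alt (suc i)
alt-step (suc (suc i)) = alt-step i
alt-step 0 ()
alt-step 1 ()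

2≢alt : ∀ i → 2F ≢ alt i
2≢alt (suc (suc i)) = 2≢alt i
2≢alt 0 ()
2≢alt 1 ()

-- This is where parity enters the lower bound: on an odd cycle the two neighbours of vertex 0 get
-- the different colours 0 and 1.
alt-odd : ∀ j → alt (suc (j * 2)) ≡ 1F
alt-odd zero    = refl
alt-odd (suc j) = alt-odd j

recolor : ℕ → ℕ → Fin 3
recolor u i with i ℕ.≟ u
... | yes _ = 2F
... | no  _ = alt i

recolor-≡ : ∀ u → recolor u u ≡ 2F
recolor-≡ u with u ℕ.≟ u
... | yes _   = refl
... | no  u≢u = contradiction refl u≢u

recolor-≢ : ∀ {u i} → i ≢ u → recolor u i ≡ alt i
recolor-≢ {u} {i} i≢u with i ℕ.≟ u
... | yes i≡u = contradiction i≡u i≢u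
... | no  _   = refl

-- Only position `u` has colour 2, and `alt` never takes that value.
recolor-step : ∀ u i → recolor u i ≢ recolor u (suc i)
recolor-step u i with i ℕ.≟ u | suc i ℕ.≟ u
... | yes refl | yes e = contradiction e ℕ.1+n≢n
... | yes _    | no  _ = 2≢alt (suc i)
... | no  _    | yes _ = ≢-sym (2≢alt i)
... | no  _    | no  _ = alt-step i

module _ {m} (3≤n : 3 ≤ suc (suc m)) where

  alternating : ProperColoring (Cycle (suc (suc m)) 3≤n) 3
  alternating = around-coloring 3≤n 2F alt alt-step (2≢alt 0) (2≢alt m)

  recolored : ℕ → ProperColoring (Cycle (suc (suc m)) 3≤n) 3
  -- Two neighbours block at most two of the three colours at vertex 0; the choice may differ from
  -- 2, which is harmless when 0 is omitted.
  recolored u with x , x≢first , x≢last ← third-color (recolor u 0) (recolor u m) =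
    around-coloring 3≤n x (recolor u) (recolor-step u) x≢first x≢last

  -- If `T` missed `suc u` as well, `recolored` would agree with `alternating` on `T` and yet differ
  -- at `suc u`.
  alternating-needs : ∀ {T} → IsDetermining alternating T → zero ∉ T → ∀ u → suc u ∈ T
  alternating-needs {T} determining 0∉T u = decidable-stable (suc u ∈? T) λ u∉T →
    2≢alt (toℕ u) (trans (sym (recolor-≡ (toℕ u)))
      (determining (recolored (toℕ u)) (agree u∉T) (suc u)))
    where
    agree : suc u ∉ T → ∀ {v} → v ∈ T → color (recolored (toℕ u)) v ≡ color alternating v
    agree u∉T {zero}  0∈T = contradiction 0∈T 0∉T
    agree u∉T {suc v} v∈T = recolor-≢ λ v≡u →
      u∉T (subst (λ w → suc w ∈ T) (toℕ-injective v≡u) v∈T)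

  alternating-critical : alt m ≡ 1F → IsCritical alternating (∁ ⁅ zero ⁆)
  alternating-critical last≡1 = forced⇒determining alternating forced , λ T determining T⊆∁0 →
    ⊆-antisym T⊆∁0 λ
      { {zero}  0∈ → contradiction 0∈ (x∉∁⁅x⁆ zero)
      ; {suc u} _  → alternating-needs determining (x∉∁⁅x⁆ zero ∘ T⊆∁0) u }
    where
    last : Fin (suc (suc m))
    last = suc m mod suc (suc m)
    toℕ-last : toℕ last ≡ suc m
    toℕ-last = toℕ-mod ℕ.≤-refl
    color-last : ∀ v → toℕ v ≡ suc m → color alternating v ≡ 1F
    color-last (suc v) e rewrite ℕ.suc-injective e = last≡1
    forced : Forced alternating zero
    forced = last , suc zero , inj₁ (inj₂ (cong suc toℕ-last , refl)) , inj₁ (inj₁ refl) ,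
      λ e → contradiction (trans (sym (color-last last toℕ-last)) e) λ ()

odd-cycle-lcsBar : ∀ j (3≤n : 3 ≤ suc (j * 2)) → IsLcsBar (Cycle (suc (j * 2)) 3≤n) (j * 2)
odd-cycle-lcsBar zero    (s≤s ())
odd-cycle-lcsBar (suc j) 3≤n =
  3 ,
  (alternating 3≤n , λ k c → forced⇒3≤ c (proj₂ (odd-cycle-forced {suc j} 3≤n c))) ,
  (alternating 3≤n ,
    (∁ ⁅ zero ⁆ , alternating-critical 3≤n (alt-odd j) , ∣∁⁅x⁆∣≡n∸1 {suc (suc j * 2)} zero) ,
    -- The same bound serves twice: for the critical sets of this colouring, and below for the
    -- maximum over all colourings.
    upper (alternating 3≤n)) ,
  λ { l (c , attained , _) → upper c l attained }
  where
  upper : ∀ c l → ∃[ X ] (IsCritical c X × ∣ X ∣ ≡ l) → l ≤ suc j * 2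
  upper c _ (_ , critical , refl) =
    s≤s⁻¹ (forced⇒critical-< c (proj₂ (odd-cycle-forced {suc j} 3≤n c)) critical)

theorem7 : (n : ℕ) (3≤n : 3 ≤ n) → n % 2 ≡ 1 → IsLcsBar (Cycle n 3≤n) (n ∸ 1)
theorem7 n 3≤n odd = go (n / 2) n≡ 3≤n
  where
  n≡ : n ≡ suc (n / 2 * 2)
  n≡ = trans (m≡m%n+[m/n]*n n 2) (cong (_+ n / 2 * 2) odd)
  -- The length is generalised so that its equation can be matched with `refl`; in `n≡` the variable
  -- `n` occurs on both sides.
  go : ∀ {n} j → n ≡ suc (j * 2) → (3≤n : 3 ≤ n) → IsLcsBar (Cycle n 3≤n) (n ∸ 1)
  go j refl = odd-cycle-lcsBar j
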